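{- Let $G$ be an Euler graph with only two types of cycles, i.e. $G\in\varepsilon_{ij}$ for some $i\neq j$ in $\{0,1,2,3\}$. Then $G$ is regular if and only if $G$ is a regular bipartite Euler graph of degree greater than $2$.
   Context: All graphs are finite, simple and connected. An Euler graph is a connected graph all of whose nodes have even degree. A cycle of length $n$ is said to be of type $i$ if $n\equiv i \pmod 4$, $i\in\{0,1,2,3\}$. For distinct $i,j\in\{0,1,2,3\}$, $\varepsilon_{ij}$ denotes the class of Euler graphs having only two types of cycles, $i$ and $j$: every cycle of $G$ has length $\equiv i$ or $\equiv j \pmod 4$, and $G$ has at least one cycle of type $i$ and at least one cycle of type $j$. -}

module Defs where

open import Data.Nat using (ℕ; zero; suc; _+_; _<_; _≤_; _%_)
open import Data.Nat.Divisibility using (_∣_)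
open import Data.Fin using (Fin; toℕ)
open import Data.Bool using (Bool; true; false; if_then_else_)
open import Data.List using (List; []; _∷_; _++_; [_]; length; map)
open import Data.Nat.ListAction using (sum)
open import Data.List.Relation.Unary.Linked using (Linked)
open import Data.List.Relation.Unary.Unique.Propositional using (Unique)
open import Data.Product using (Σ; ∃; _×_; _,_)
open import Data.Sum using (_⊎_)
open import Relation.Binary.PropositionalEquality using (_≡_)
import Data.List as L

record Graph (n : ℕ) : Set where
  field
    adj    : Fin n → Fin n → Bool
    sym    : ∀ u v → adj u v ≡ adj v u
    irrefl : ∀ v → adj v v ≡ false

open Graph public

Adj : ∀ {n} → Graph n → Fin n → Fin n → Set
Adj G u v = adj G u v ≡ true

vertices : (n : ℕ) → List (Fin n)
vertices n = L.allFin n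

degree : ∀ {n} → Graph n → Fin n → ℕ
degree {n} G v = sum (map (λ u → if adj G v u then 1 else 0) (vertices n))

data Walk {n} (G : Graph n) : Fin n → Fin n → Set where
  here : ∀ {v} → Walk G v v
  step : ∀ {u w v} → Adj G u w → Walk G w v → Walk G u v

Connected : ∀ {n} → Graph n → Set
Connected {n} G = (u v : Fin n) → Walk G u v

Euler : ∀ {n} → Graph n → Set
Euler {n} G = Connected G × ((v : Fin n) → 2 ∣ degree G v)

IsCycle : ∀ {n} → Graph n → List (Fin n) → Set
IsCycle G []       = Data.Empty.⊥
  where import Data.Empty
IsCycle G (v ∷ vs) = 3 ≤ length (v ∷ vs) × Unique (v ∷ vs)
                   × Linked (Adj G) ((v ∷ vs) ++ [ v ])

HasCycleOfLength : ∀ {n} → Graph n → ℕ → Set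
HasCycleOfLength {n} G k = Σ (List (Fin n)) λ c → IsCycle G c × length c ≡ k

InEpsilon : ∀ {n} → Fin 4 → Fin 4 → Graph n → Set
InEpsilon i j G =
    (∀ k → HasCycleOfLength G k → (k % 4 ≡ toℕ i) ⊎ (k % 4 ≡ toℕ j))
  × (∃ λ k → HasCycleOfLength G k × k % 4 ≡ toℕ i)
  × (∃ λ k → HasCycleOfLength G k × k % 4 ≡ toℕ j)

RegularOfDegree : ∀ {n} → Graph n → ℕ → Set
RegularOfDegree {n} G d = (v : Fin n) → degree G v ≡ d

Regular : ∀ {n} → Graph n → Set
Regular G = ∃ λ d → RegularOfDegree G d

Bipartite : ∀ {n} → Graph n → Set
Bipartite {n} G = Σ (Fin n → Bool) λ col → ∀ u v → Adj G u v → col u ≡ col v → Data.Empty.⊥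
  where import Data.Empty

{-# OPTIONS --safe #-}
-- A regular graph of degree 0 has no cycle, and in a connected 2-regular graph every cycle passes
-- through all vertices, so two cycle types force the (even) degree to be at least 4.  If i and j
-- are both even there are no odd cycles and G is bipartite.  All other pairs {i , j} are impossible
-- for minimum degree 4.  Extending a path at its start u, and rotating it along chords
-- (x₀ … x_{b-1} x_b …  ↦  x_{b-1} … x₀ x_b …) so that its head H = x₀ … x_{b-1} gets ever shorter,
-- one reaches a path H ++ b ∷ T whose head has both ends u, v joined to b, where u has neighbours
-- c, d and v has neighbours s, t in T.  With h = |H| and y, z the distances from b to c and from c
-- to d, there are cycles of lengths h+1, h+y+1, h+y+z+1, y+2, z+2 and y+z+2; if no two cycle
-- lengths differ by 2 modulo 4, then h ≡ 1 or y ≡ z ≡ 0, and likewise for v.  Choose w ∈ {s , t}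
-- different from c, at distance g from c; closing the segment between c and w through H, or
-- through u b v, gives cycles of lengths h+g+1 and g+4.  If h ≡ 1, these differ by 2; otherwise
-- y ≡ g ≡ 0, and the cycles of lengths g+4 and y+2 differ by 2.  The remaining pair {1 , 3} is excluded
-- because y+2, z+2 and y+z+2 are not all odd.

module Submission where

open import Defs
open import Data.Bool using (Bool; true; false; not; _xor_; if_then_else_)
import Data.Bool.Properties as Bool
open import Data.Empty using (⊥; ⊥-elim)
open import Data.Fin using (Fin; toℕ)
import Data.Fin.Properties as Fin
open import Data.List using (List; []; _∷_; _++_; [_]; length; map; filter; reverse)
open import Data.List.Properties using (length-++; ++-assoc; filter-++; filter-reject; length-reverse; unfold-reverse; ∷-injective; length-tabulate; ++-identityʳ)
open import Data.List.Membership.Propositional using (_∈_; _∉_; find)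
open import Data.List.Membership.Propositional.Properties using (∈-∃++; ∈-++⁺ˡ; ∈-++⁺ʳ; ∈-++⁻; ∈-insert; ∈-filter⁺; ∈-filter⁻; ∈-allFin)
open import Data.List.Relation.Binary.Disjoint.Propositional using (Disjoint)
open import Data.List.Relation.Binary.Permutation.Propositional using (_↭_; ↭-sym; ↭⇒↭ₛ)
open import Data.List.Relation.Binary.Permutation.Propositional.Properties using (∈-resp-↭; ↭-length; ↭-reverse; ++-comm; shifts)
import Data.List.Relation.Binary.Permutation.Setoid.Properties as Permutation
open import Data.List.Relation.Binary.Subset.Propositional using (_⊆_)
open import Data.List.Relation.Unary.All as All using (All; []; _∷_)
open import Data.List.Relation.Unary.All.Properties as All using (¬All⇒Any¬)
open import Data.List.Relation.Unary.Any using (here; there)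
open import Data.List.Relation.Unary.AllPairs using ([]; _∷_)
open import Data.List.Relation.Unary.Linked using (Linked; [-]; _∷_)
open import Data.List.Relation.Unary.Unique.Propositional using (Unique)
import Data.List.Relation.Unary.Unique.Propositional.Properties as Unique
open import Data.Nat using (ℕ; zero; suc; _+_; _<_; _≤_; _%_; z≤n; s≤s)
open import Data.Nat.DivMod using (_mod_; %-distribˡ-+; m%n%n≡m%n; m%n<n; m<n⇒m%n≡m)
open import Data.Nat.Divisibility using (_∣_; _∣?_)
open import Data.Nat.ListAction using (sum)
open import Data.Nat.Properties
open import Data.Product using (∃; _×_; _,_; proj₁; proj₂)
open import Data.Sum as Sum using (_⊎_; inj₁; inj₂; [_,_]′)
open import Function using (_∘_)
open import Function.Bundles using (_⇔_; mk⇔)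
open import Relation.Binary.PropositionalEquality as ≡ using (_≡_; _≢_; refl; cong; cong₂; subst; trans)
open import Relation.Nullary using (¬_; Dec; yes; no; ¬?; _×-dec_; _⊎-dec_; _→-dec_; from-yes; from-no)
open import Relation.Unary using (Decidable)
open import Relation.Binary.Definitions using (DecidableEquality)

-- Parity and residues modulo 4.

odd : ℕ → Bool
odd zero    = false
odd (suc k) = not (odd k)

odd-+ : ∀ m n → odd (m + n) ≡ odd m xor odd n
odd-+ zero    n = refl
odd-+ (suc m) n = trans (cong not (odd-+ m n)) (Bool.not-distribˡ-xor (odd m) (odd n))

odd-%4 : ∀ k → odd k ≡ odd (k % 4)
odd-%4 0 = refl
odd-%4 1 = refl
odd-%4 2 = refl
odd-%4 3 = refl
-- Four successors cancel in `_% 4` by computation, so only the fourfold negation has to be removed.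
odd-%4 (suc (suc (suc (suc k)))) =
  trans (Bool.not-involutive (not (not (odd k)))) (trans (Bool.not-involutive (odd k)) (odd-%4 k))

Allowed : Fin 4 → Fin 4 → ℕ → Set
Allowed i j k = (k % 4 ≡ toℕ i) ⊎ (k % 4 ≡ toℕ j)

allowed? : ∀ i j k → Dec (Allowed i j k)
allowed? i j k = (k % 4 ≟ toℕ i) ⊎-dec (k % 4 ≟ toℕ j)

infix 4 _≈₄_

-- A record rather than a bare equation of remainders, so that `m` and `n` can be inferred by
-- unification; `_% 4` is not injective.
record _≈₄_ (m n : ℕ) : Set where
  constructor congruent
  field residues≡ : m % 4 ≡ n % 4

open _≈₄_

≈₄-refl : ∀ {m} → m ≈₄ m
≈₄-refl = congruent refl

≈₄-sym : ∀ {m n} → m ≈₄ n → n ≈₄ m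
≈₄-sym p = congruent (≡.sym (residues≡ p))

≈₄-trans : ∀ {m n o} → m ≈₄ n → n ≈₄ o → m ≈₄ o
≈₄-trans p q = congruent (trans (residues≡ p) (residues≡ q))

+-cong₄ : ∀ {m m′ n n′} → m ≈₄ m′ → n ≈₄ n′ → m + n ≈₄ m′ + n′
+-cong₄ {m} {m′} {n} {n′} p q = congruent (begin
  (m + n) % 4               ≡⟨ %-distribˡ-+ m n 4 ⟩
  (m % 4 + n % 4) % 4       ≡⟨ cong₂ (λ a b → (a + b) % 4) (residues≡ p) (residues≡ q) ⟩
  (m′ % 4 + n′ % 4) % 4     ≡⟨ ≡.sym (%-distribˡ-+ m′ n′ 4) ⟩
  (m′ + n′) % 4             ∎)
  where open ≡.≡-Reasoning

residue : ∀ k → ∃ λ (r : Fin 4) → k ≈₄ toℕ r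
residue k = k mod 4 , congruent (≡.sym (trans (cong (_% 4) (Fin.toℕ-fromℕ< (m%n<n k 4))) (m%n%n≡m%n k 4)))

allowed-resp : ∀ {i j k l} → k ≈₄ l → Allowed i j k → Allowed i j l
allowed-resp eq (inj₁ p) = inj₁ (trans (≡.sym (residues≡ eq)) p)
allowed-resp eq (inj₂ p) = inj₂ (trans (≡.sym (residues≡ eq)) p)

-- Adding 2 is an involution modulo 4, so this single inequality is symmetric in `i` and `j`. For
-- distinct types it leaves exactly the pairs of adjacent residues.
NotOpposite : Fin 4 → Fin 4 → Set
NotOpposite i j = (toℕ i + 2) % 4 ≢ toℕ j

-- Abstract, since later with-abstractions would otherwise unfold these exhaustive checks.
abstract

  -- Let the types be adjacent residues. Unless `y` and `z` both vanish, the lengths `y+2`, `z+2`,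
  -- `y+z+2` take both allowed residues, and the lengths through `h` fit the same pair only for
  -- `h ≡ 1`. Hypotheses come between the quantifiers so that the exhaustive check prunes early.
  fan-table : ∀ (i j : Fin 4) → ¬ (i ≡ j) → odd (toℕ i) ≡ true ⊎ odd (toℕ j) ≡ true →
    ∀ (y : Fin 4) → Allowed i j (1 + (toℕ y + 1)) →
    ∀ (z : Fin 4) → Allowed i j (1 + (toℕ z + 1)) → Allowed i j (1 + (toℕ y + toℕ z + 1)) →
    ∀ (h : Fin 4) → Allowed i j (toℕ h + 1) → Allowed i j (toℕ h + (toℕ y + 1)) →
    Allowed i j (toℕ h + (toℕ y + toℕ z + 1)) →
    NotOpposite i j × (toℕ h ≡ 1 ⊎ (toℕ y ≡ 0 × toℕ z ≡ 0))
  fan-table = from-yes (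
    Fin.all? {n = 4} λ i → Fin.all? {n = 4} λ j → ¬? (i Fin.≟ j) →-dec
    ((odd (toℕ i) Bool.≟ true) ⊎-dec (odd (toℕ j) Bool.≟ true)) →-dec
    Fin.all? {n = 4} λ y → allowed? i j (1 + (toℕ y + 1)) →-dec
    Fin.all? {n = 4} λ z → allowed? i j (1 + (toℕ z + 1)) →-dec allowed? i j (1 + (toℕ y + toℕ z + 1)) →-dec
    Fin.all? {n = 4} λ h → allowed? i j (toℕ h + 1) →-dec allowed? i j (toℕ h + (toℕ y + 1)) →-dec
    allowed? i j (toℕ h + (toℕ y + toℕ z + 1)) →-dec
    (¬? ((toℕ i + 2) % 4 ≟ toℕ j) ×-dec
     ((toℕ h ≟ 1) ⊎-dec ((toℕ y ≟ 0) ×-dec (toℕ z ≟ 0)))))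

  -- Each alternative yields two lengths with opposite residues: `g+4` and `g+2` if `h ≡ 1`, and 0
  -- and 2 if `y ≡ g ≡ 0`.
  crossing-table : ∀ (i j : Fin 4) → NotOpposite i j → ∀ (g : Fin 4) → Allowed i j (3 + (toℕ g + 1)) →
    ∀ (h : Fin 4) → Allowed i j (toℕ h + (toℕ g + 1)) →
    ∀ (y : Fin 4) → Allowed i j (1 + (toℕ y + 1)) →
    ¬ (toℕ h ≡ 1 ⊎ (toℕ y ≡ 0 × toℕ g ≡ 0))
  crossing-table = from-yes (
    Fin.all? {n = 4} λ i → Fin.all? {n = 4} λ j → ¬? ((toℕ i + 2) % 4 ≟ toℕ j) →-dec
    Fin.all? {n = 4} λ g → allowed? i j (3 + (toℕ g + 1)) →-dec
    Fin.all? {n = 4} λ h → allowed? i j (toℕ h + (toℕ g + 1)) →-dec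
    Fin.all? {n = 4} λ y → allowed? i j (1 + (toℕ y + 1)) →-dec
    ¬? ((toℕ h ≟ 1) ⊎-dec ((toℕ y ≟ 0) ×-dec (toℕ g ≟ 0))))

fan-residues : ∀ {i j : Fin 4} → ¬ (i ≡ j) → odd (toℕ i) ≡ true ⊎ odd (toℕ j) ≡ true → ∀ h y z →
  Allowed i j (1 + (y + 1)) → Allowed i j (1 + (z + 1)) → Allowed i j (1 + (y + z + 1)) →
  Allowed i j (h + 1) → Allowed i j (h + (y + 1)) → Allowed i j (h + (y + z + 1)) →
  NotOpposite i j × (h ≈₄ 1 ⊎ (y ≈₄ 0 × z ≈₄ 0))
fan-residues {i} {j} i≢j o h y z a₁ a₂ a₃ a₄ a₅ a₆ =
  let h′ , h≈ = residue h
      y′ , y≈ = residue y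
      z′ , z≈ = residue z
      1≈      = ≈₄-refl {1}
      y+1≈    = +-cong₄ y≈ 1≈
      y+z+1≈  = +-cong₄ (+-cong₄ y≈ z≈) 1≈
      opp , alternatives = fan-table i j i≢j o
        y′ (allowed-resp (+-cong₄ 1≈ y+1≈) a₁)
        z′ (allowed-resp (+-cong₄ 1≈ (+-cong₄ z≈ 1≈)) a₂)
           (allowed-resp (+-cong₄ 1≈ y+z+1≈) a₃)
        h′ (allowed-resp (+-cong₄ h≈ 1≈) a₄)
           (allowed-resp (+-cong₄ h≈ y+1≈) a₅)
           (allowed-resp (+-cong₄ h≈ y+z+1≈) a₆)
  in opp , Sum.map (λ p → subst (h ≈₄_) p h≈)
                   (λ (p , q) → subst (y ≈₄_) p y≈ , subst (z ≈₄_) q z≈) alternatives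

crossing-residues : ∀ {i j : Fin 4} → NotOpposite i j → ∀ h y g →
  Allowed i j (3 + (g + 1)) → Allowed i j (h + (g + 1)) → Allowed i j (1 + (y + 1)) →
  ¬ (h ≈₄ 1 ⊎ (y ≈₄ 0 × g ≈₄ 0))
crossing-residues {i} {j} opp h y g a₁ a₂ a₃ alternatives =
  let h′ , h≈ = residue h
      y′ , y≈ = residue y
      g′ , g≈ = residue g
      g+1≈    = +-cong₄ g≈ (≈₄-refl {1})
  in crossing-table i j opp
       g′ (allowed-resp (+-cong₄ (≈₄-refl {3}) g+1≈) a₁)
       h′ (allowed-resp (+-cong₄ h≈ g+1≈) a₂)
       y′ (allowed-resp (+-cong₄ (≈₄-refl {1}) (+-cong₄ y≈ (≈₄-refl {1}))) a₃)
       (Sum.map (small h′ h≈) (λ (p , q) → small y′ y≈ p , small g′ g≈ q) alternatives)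
  where
  small : ∀ {k l} (r : Fin 4) → k ≈₄ toℕ r → k ≈₄ l → toℕ r ≡ l % 4
  small r p q = trans (≡.sym (m<n⇒m%n≡m (Fin.toℕ<n r))) (residues≡ (≈₄-trans (≈₄-sym p) q))

+-cancel₄ : ∀ {m g} → m ≈₄ 0 → m + g ≈₄ 0 → g ≈₄ 0
+-cancel₄ {m} {g} p q = ≈₄-trans (+-cong₄ (≈₄-sym p) (≈₄-refl {g})) q

-- Lists without repetition and positions in a list.

module _ {A : Set} where

  unique-resp-↭ : {xs ys : List A} → xs ↭ ys → Unique xs → Unique ys
  unique-resp-↭ p = Permutation.Unique-resp-↭ (≡.setoid A) (↭⇒↭ₛ p)

  unique-++⁻ : (xs : List A) {ys : List A} → Unique (xs ++ ys) →
               Unique xs × Unique ys × Disjoint xs ys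
  unique-++⁻ []       uniq         = [] , uniq , λ ()
  unique-++⁻ (x ∷ xs) (x∉ ∷ uniq) with unique-++⁻ xs uniq
  ... | uxs , uys , disj = All.++⁻ˡ xs x∉ ∷ uxs , uys , λ
    { (here refl , v∈ys) → All.lookup (All.++⁻ʳ xs x∉) v∈ys refl
    ; (there v∈xs , v∈ys) → disj (v∈xs , v∈ys) }

  -- Pigeonhole by induction: delete one occurrence of `x` from `ys`; the remaining entries of `xs`
  -- differ from `x` and survive the deletion.
  unique⇒length-≤ : {xs ys : List A} → Unique xs → xs ⊆ ys → length xs ≤ length ys
  unique⇒length-≤ {[]}     _           _  = z≤n
  unique⇒length-≤ {x ∷ xs} (x∉ ∷ uniq) xs⊆ with ∈-∃++ (xs⊆ (here refl))
  ... | as , bs , refl = begin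
      suc (length xs)               ≤⟨ s≤s (unique⇒length-≤ uniq without-x) ⟩
      suc (length (as ++ bs))       ≡⟨ cong suc (length-++ as) ⟩
      suc (length as + length bs)   ≡⟨ ≡.sym (+-suc (length as) (length bs)) ⟩
      length as + suc (length bs)   ≡⟨ ≡.sym (length-++ as) ⟩
      length (as ++ x ∷ bs)         ∎
    where
    open ≤-Reasoning
    without-x : xs ⊆ as ++ bs
    without-x v∈xs with ∈-++⁻ as (xs⊆ (there v∈xs))
    ... | inj₁ v∈as           = ∈-++⁺ˡ v∈as
    ... | inj₂ (here refl)    = ⊥-elim (All.lookup x∉ v∈xs refl)
    ... | inj₂ (there v∈bs)   = ∈-++⁺ʳ as v∈bs

  -- Relative position of two marked entries of one list; `ms` is the stretch strictly between them
  -- and later yields their distance.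
  data TwoSplits (xs ys zs ws : List A) (x z : A) : Set where
    same   : xs ≡ zs → x ≡ z → TwoSplits xs ys zs ws x z
    before : ∀ ms → zs ≡ xs ++ x ∷ ms → ys ≡ ms ++ z ∷ ws → TwoSplits xs ys zs ws x z
    after  : ∀ ms → xs ≡ zs ++ z ∷ ms → ws ≡ ms ++ x ∷ ys → TwoSplits xs ys zs ws x z

  compare-splits : ∀ xs {ys} zs {ws} {x z : A} → xs ++ x ∷ ys ≡ zs ++ z ∷ ws →
                   TwoSplits xs ys zs ws x z
  compare-splits []       []       refl = same refl refl
  compare-splits []       (_ ∷ zs) refl = before zs refl refl
  compare-splits (_ ∷ xs) []       refl = after xs refl refl
  compare-splits (a ∷ xs) (_ ∷ zs) eq with ∷-injective eq
  ... | refl , eq′ with compare-splits xs zs eq′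
  ...   | same p q        = same (cong (a ∷_) p) q
  ...   | before ms p q   = before ms (cong (a ∷_) p) q
  ...   | after ms p q    = after ms (cong (a ∷_) p) q

  repetition? : DecidableEquality A → (xs : List A) →
    Unique xs ⊎ (∃ λ as → ∃ λ x → ∃ λ bs → ∃ λ cs → xs ≡ as ++ x ∷ bs ++ x ∷ cs)
  repetition? _≟_ []       = inj₁ []
  repetition? _≟_ (x ∷ xs) with x ∈? xs
    where open import Data.List.Membership.DecPropositional _≟_ using (_∈?_)
  ... | yes x∈xs with ∈-∃++ x∈xs
  ...   | bs , cs , refl = inj₂ ([] , x , bs , cs , refl)
  repetition? _≟_ (x ∷ xs) | no x∉xs with repetition? _≟_ xs
  ... | inj₁ uniq                   = inj₁ (All.¬Any⇒All¬ xs x∉xs ∷ uniq)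
  ... | inj₂ (as , y , bs , cs , refl) = inj₂ (x ∷ as , y , bs , cs , refl)

-- Adjacency and counting neighbours.

module _ {n : ℕ} (G : Graph n) where

  open import Data.List.Membership.DecPropositional (Fin._≟_ {n}) using (_∈?_)

  adj-sym : ∀ {u v} → Adj G u v → Adj G v u
  adj-sym {u} {v} = trans (sym G v u)

  adj-irrefl : ∀ {v} → ¬ Adj G v v
  adj-irrefl {v} e with trans (≡.sym e) (irrefl G v)
  ... | ()

  adj⇒≢ : ∀ {u v} → Adj G u v → u ≢ v
  adj⇒≢ e refl = adj-irrefl e

  adj? : ∀ u → Decidable (Adj G u)
  adj? u v = adj G u v Bool.≟ true

  count : Fin n → List (Fin n) → ℕ
  count u xs = length (filter (adj? u) xs)

  degree≡count : ∀ u → degree G u ≡ count u (vertices n)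
  degree≡count u = go (vertices n)
    where
    go : ∀ xs → sum (map (λ w → if adj G u w then 1 else 0) xs) ≡ count u xs
    go []       = refl
    go (x ∷ xs) with adj G u x
    ... | true  = cong suc (go xs)
    ... | false = go xs

  neighbours-≤-degree : ∀ {u xs} → Unique xs → All (Adj G u) xs → length xs ≤ degree G u
  neighbours-≤-degree {u} uniq u~xs = subst (_ ≤_) (≡.sym (degree≡count u))
    (unique⇒length-≤ uniq λ v∈xs → ∈-filter⁺ (adj? u) (∈-allFin _) (All.lookup u~xs v∈xs))

  -- The dichotomy that drives path growth: a neighbour off the path extends it, and otherwise all
  -- neighbours lie on the path and can serve as ends of chords.
  outside-neighbour? : ∀ u xs → (∃ λ x → Adj G u x × x ∉ xs) ⊎ degree G u ≤ count u xs
  outside-neighbour? u xs with All.all? (_∈? xs) (filter (adj? u) (vertices n))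
  ... | yes inside = inj₂ (subst (_≤ count u xs) (≡.sym (degree≡count u))
          (unique⇒length-≤ (Unique.filter⁺ (adj? u) (Unique.allFin⁺ n))
            λ v∈ → ∈-filter⁺ (adj? u) (All.lookup inside v∈) (proj₂ (∈-filter⁻ (adj? u) {xs = vertices n} v∈))))
  ... | no ¬inside with find (¬All⇒Any¬ (_∈? xs) _ ¬inside)
  ...   | x , x∈ , x∉xs = inj₁ (x , proj₂ (∈-filter⁻ (adj? u) {xs = vertices n} x∈) , x∉xs)

  count-∷-≤ : ∀ u x xs → count u (x ∷ xs) ≤ suc (count u xs)
  count-∷-≤ u x xs with adj? u x
  ... | yes _ = ≤-refl
  ... | no _  = n≤1+n _

  count-self : ∀ u xs → count u (u ∷ xs) ≡ count u xs
  count-self u xs = cong length (filter-reject (adj? u) adj-irrefl)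

  count-++ : ∀ u xs ys → count u (xs ++ ys) ≡ count u xs + count u ys
  count-++ u xs ys = trans (cong length (filter-++ (adj? u) xs ys)) (length-++ (filter (adj? u) xs))

  -- The bound by `count u bs` says that at most one neighbour is used up, so the search can be
  -- repeated in `bs`.
  first-neighbour : ∀ u xs → 0 < count u xs →
    ∃ λ as → ∃ λ y → ∃ λ bs → xs ≡ as ++ y ∷ bs × Adj G u y × count u xs ≤ suc (count u bs)
  first-neighbour u (x ∷ xs) pos with adj G u x in eq
  ... | true  = [] , x , xs , refl , eq , ≤-refl
  ... | false with first-neighbour u xs pos
  ...   | as , y , bs , refl , u~y , le = x ∷ as , y , bs , refl , u~y , le

  TwoNeighboursIn : Fin n → List (Fin n) → Set
  TwoNeighboursIn u xs = ∃ λ as → ∃ λ c → ∃ λ bs → ∃ λ d → ∃ λ cs →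
    xs ≡ as ++ c ∷ bs ++ d ∷ cs × Adj G u c × Adj G u d

  two-neighbours : ∀ u xs → 2 ≤ count u xs → TwoNeighboursIn u xs
  two-neighbours u xs two with first-neighbour u xs (≤-trans (s≤s z≤n) two)
  ... | as , c , ys , refl , u~c , le with first-neighbour u ys (≤-pred (≤-trans two le))
  ...   | bs , d , cs , refl , u~d , _ = as , c , bs , d , cs , refl , u~c , u~d

  -- Chains, paths and the cycles they close.

  -- A walk indexed by its vertex list and both ends, so that lengths and distinctness become
  -- statements about lists. The list is never empty.
  data Chain : List (Fin n) → Fin n → Fin n → Set where
    [-] : ∀ {u} → Chain [ u ] u u
    _∷_ : ∀ {u w v xs} → Adj G u w → Chain xs w v → Chain (u ∷ xs) u v

  chain-head : ∀ {x xs u v} → Chain (x ∷ xs) u v → x ≡ u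
  chain-head [-]     = refl
  chain-head (_ ∷ _) = refl

  chain-∈ˡ : ∀ {xs u v} → Chain xs u v → u ∈ xs
  chain-∈ˡ [-]     = here refl
  chain-∈ˡ (_ ∷ _) = here refl

  chain-∈ʳ : ∀ {xs u v} → Chain xs u v → v ∈ xs
  chain-∈ʳ [-]     = here refl
  chain-∈ʳ (_ ∷ c) = there (chain-∈ʳ c)

  chain-++ : ∀ {xs ys u v w z} → Chain xs u v → Adj G v w → Chain ys w z → Chain (xs ++ ys) u z
  chain-++ [-]     e d = e ∷ d
  chain-++ (a ∷ c) e d = a ∷ chain-++ c e d

  chain-reverse : ∀ {xs u v} → Chain xs u v → Chain (reverse xs) v u
  chain-reverse [-] = [-]
  chain-reverse (_∷_ {u} {xs = xs} a c) =
    subst (λ ys → Chain ys _ _) (≡.sym (unfold-reverse u xs)) (chain-++ (chain-reverse c) (adj-sym a) [-])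

  chain-split : ∀ {x} xs {y ys u v} → Chain (x ∷ xs ++ y ∷ ys) u v →
                ∃ λ w → Chain (x ∷ xs) u w × Adj G w y × Chain (y ∷ ys) y v
  chain-split []       (a ∷ c) with chain-head c
  ... | refl = _ , [-] , a , c
  chain-split (_ ∷ xs) (a ∷ c) with chain-split xs c
  ... | w , c₁ , e , c₂ = w , a ∷ c₁ , e , c₂

  chain-suffix : ∀ xs {y ys u v} → Chain (xs ++ y ∷ ys) u v → Chain (y ∷ ys) y v
  chain-suffix []       c with chain-head c
  ... | refl = c
  chain-suffix (x ∷ xs) c = proj₂ (proj₂ (proj₂ (chain-split xs c)))

  -- Serves both to truncate a path at `y` and to shortcut a closed walk past a loop.
  chain-replace : ∀ xs {y ys zs u v w} → Chain (xs ++ y ∷ ys) u v → Chain (y ∷ zs) y w →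
                  Chain (xs ++ y ∷ zs) u w
  chain-replace []       c d with chain-head c
  ... | refl = d
  chain-replace (x ∷ xs) c d with chain-split xs c
  ... | _ , c₁ , e , _ = chain-++ c₁ e d

  chain⇒linked : ∀ {xs u v w} → Chain xs u v → Adj G v w → Linked (Adj G) (xs ++ [ w ])
  chain⇒linked [-]               e = e ∷ [-]
  chain⇒linked (a ∷ [-])         e = a ∷ e ∷ [-]
  chain⇒linked (a ∷ c@(_ ∷ _))   e = a ∷ chain⇒linked c e

  linked⇒chain : ∀ x xs {w} → Linked (Adj G) (x ∷ xs ++ [ w ]) → ∃ λ v → Chain (x ∷ xs) x v × Adj G v w
  linked⇒chain x []       (a ∷ [-]) = x , [-] , a
  linked⇒chain x (y ∷ xs) (a ∷ l) with linked⇒chain y xs l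
  ... | v , c , e = v , a ∷ c , e

  cycle : ∀ {xs u v} → Chain xs u v → Adj G v u → Unique xs → 3 ≤ length xs →
          HasCycleOfLength G (length xs)
  cycle c@[-]     e uniq 3≤ = _ , (3≤ , uniq , chain⇒linked c e) , refl
  cycle c@(_ ∷ _) e uniq 3≤ = _ , (3≤ , uniq , chain⇒linked c e) , refl

  Path : List (Fin n) → Fin n → Fin n → Set
  Path xs u v = Chain xs u v × Unique xs

  path-reverse : ∀ {xs u v} → Path xs u v → Path (reverse xs) v u
  path-reverse {xs} (c , uniq) = chain-reverse c , unique-resp-↭ (↭-sym (↭-reverse xs)) uniq

  path-prefix : ∀ xs {y ys u v} → Path (xs ++ y ∷ ys) u v → Path (xs ++ [ y ]) u y
  path-prefix xs {y} {ys} (c , uniq) =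
    chain-replace xs c [-] ,
    proj₁ (unique-++⁻ (xs ++ [ y ]) (subst Unique (≡.sym (++-assoc xs [ y ] ys)) uniq))

  path-suffix : ∀ xs {y ys u v} → Path (xs ++ y ∷ ys) u v → Path (y ∷ ys) y v
  path-suffix xs (c , uniq) = chain-suffix xs c , proj₁ (proj₂ (unique-++⁻ xs uniq))

  ∈-prefix : ∀ xs {x y : Fin n} {ys} → x ∈ xs ++ [ y ] → x ∈ xs ++ y ∷ ys
  ∈-prefix xs x∈ with ∈-++⁻ xs x∈
  ... | inj₁ x∈xs        = ∈-++⁺ˡ x∈xs
  ... | inj₂ (here refl) = ∈-insert xs

  path-ends-≢ : ∀ {xs u v} → Path xs u v → 2 ≤ length xs → u ≢ v
  path-ends-≢ (_ ∷ c , u∉ ∷ _) _ refl = All.lookup u∉ (chain-∈ʳ c) refl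
  path-ends-≢ ([-] , _) (s≤s ()) _

  -- All cycles read off a lobe have this shape: one path is the head, a single end of it, or the
  -- detour through `b`; the other is a segment of `b ∷ T`.
  two-paths⇒cycle : ∀ {xs ys u v w z} → Path xs u v → Path ys w z → Disjoint xs ys →
    Adj G v w → Adj G z u → 3 ≤ length xs + length ys → HasCycleOfLength G (length xs + length ys)
  two-paths⇒cycle {xs} {ys} (c , uxs) (d , uys) disj e f 3≤ =
    subst (HasCycleOfLength G) (length-++ xs)
      (cycle (chain-++ c e d) f (Unique.++⁺ uxs uys disj) (subst (3 ≤_) (≡.sym (length-++ xs)) 3≤))

  -- Lobes, and rotation of long paths.

  -- The head `H` closes to a cycle through `b`, from which the tail `T` continues. The bound `2≤H`
  -- makes the ends of the head distinct and this closure a genuine cycle.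
  record Lobe : Set where
    field
      {u v b e} : Fin n
      H T       : List (Fin n)
      path-H    : Path H u v
      path-T    : Path (b ∷ T) b e
      disjoint  : Disjoint H (b ∷ T)
      u~b       : Adj G u b
      v~b       : Adj G v b
      2≤H       : 2 ≤ length H

    total : ℕ
    total = length H + suc (length T)

    whole : Path (H ++ b ∷ T) u e
    whole = chain-++ (proj₁ path-H) v~b (proj₁ path-T) ,
            Unique.++⁺ (proj₂ path-H) (proj₂ path-T) disjoint

  -- This is the rotation along the chord from `u` to `b`. It exchanges `u` and `v`, so facts proved
  -- at `u` carry over to `v`.
  reverse-lobe : Lobe → Lobe
  reverse-lobe L = record
    { H = reverse H ; T = T
    ; path-H = path-reverse path-H
    ; path-T = path-T
    ; disjoint = λ (v∈ , v∈T) → disjoint (∈-resp-↭ (↭-reverse H) v∈ , v∈T)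
    ; u~b = v~b ; v~b = u~b
    ; 2≤H = subst (2 ≤_) (≡.sym (length-reverse H)) 2≤H
    }
    where open Lobe L

  total-reverse : ∀ L → Lobe.total (reverse-lobe L) ≡ Lobe.total L
  total-reverse L = cong (_+ suc (length (Lobe.T L))) (length-reverse (Lobe.H L))

  chord⇒lobe : ∀ {x₀ x₁ y e} as {bs} → Path (x₀ ∷ x₁ ∷ as ++ y ∷ bs) x₀ e → Adj G x₀ y → Lobe
  chord⇒lobe {x₀} {x₁} as {bs} (c , uniq) x₀~y =
    let _ , c₁ , w~y , c₂ = chain-split (x₁ ∷ as) c
        uniq₁ , uniq₂ , disj = unique-++⁻ (x₀ ∷ x₁ ∷ as) uniq
    in record
      { H = x₀ ∷ x₁ ∷ as ; T = bs
      ; path-H = c₁ , uniq₁ ; path-T = c₂ , uniq₂ ; disjoint = disj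
      ; u~b = x₀~y ; v~b = w~y ; 2≤H = s≤s (s≤s z≤n) }

  Longer : ℕ → Set
  Longer m = ∃ λ xs → ∃ λ u → ∃ λ v → Path xs u v × m < length xs

  Tighter : Lobe → Set
  Tighter L = ∃ λ L′ → Lobe.total L′ ≡ Lobe.total L × length (Lobe.H L′) < length (Lobe.H L)

  extend : ∀ {xs u v x} → Path xs u v → Adj G u x → x ∉ xs → Path (x ∷ xs) x v
  extend {xs} (c , uniq) u~x x∉ = adj-sym u~x ∷ c , All.¬Any⇒All¬ xs x∉ ∷ uniq

  -- A neighbour of `u` off the path extends it; one in the head beyond `x₁` cuts off a shorter head
  -- of the same path. Failing both, only `x₁` and `b` can be neighbours outside `T`, so at least
  -- two of the four lie in `T`.
  improve : (∀ v → 4 ≤ degree G v) → ∀ L → let open Lobe L in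
            Longer total ⊎ Tighter L ⊎ TwoNeighboursIn u T
  improve 4≤deg L@record { H = x₀ ∷ x₁ ∷ H ; T = T ; u = u ; b = b } with outside-neighbour? u (x₀ ∷ x₁ ∷ H ++ b ∷ T)
  ... | inj₁ (x , u~x , x∉) = inj₁ (_ , _ , _ , extend (Lobe.whole L) u~x x∉ ,
          s≤s (≤-reflexive (≡.sym (length-++ (x₀ ∷ x₁ ∷ H)))))
  ... | inj₂ deg≤ with chain-head (proj₁ (Lobe.path-H L))
  ...   | refl with ≤-trans (4≤deg u) deg≤
  ...     | 4≤count with count u H in eq
  ...       | suc _ with first-neighbour u H (subst (0 <_) (≡.sym eq) (s≤s z≤n))
  ...         | as , y , bs , refl , u~y , _ = inj₂ (inj₁
                  ( chord⇒lobe {x₁ = x₁} as (subst (λ xs → Path (u ∷ x₁ ∷ xs) u (Lobe.e L)) (++-assoc as (y ∷ bs) (b ∷ T)) (Lobe.whole L)) u~y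
                  , cong (suc ∘ suc) length-eq
                  , s≤s (s≤s (subst (length as <_) (≡.sym (length-++ as)) (m<m+n (length as) (s≤s z≤n))))))
    where
    open ≡.≡-Reasoning
    length-eq : length as + suc (length (bs ++ b ∷ T)) ≡ length (as ++ y ∷ bs) + suc (length T)
    length-eq = begin
      length as + length (y ∷ bs ++ b ∷ T)        ≡⟨ ≡.sym (length-++ as) ⟩
      length (as ++ (y ∷ bs) ++ b ∷ T)            ≡⟨ cong length (≡.sym (++-assoc as (y ∷ bs) (b ∷ T))) ⟩
      length ((as ++ y ∷ bs) ++ b ∷ T)            ≡⟨ length-++ (as ++ y ∷ bs) ⟩
      length (as ++ y ∷ bs) + suc (length T)      ∎
  improve 4≤deg L@record { H = x₀ ∷ x₁ ∷ H ; T = T ; u = u ; b = b } | inj₂ deg≤ | refl | 4≤count | zero =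
    inj₂ (inj₂ (two-neighbours u T (≤-pred (≤-pred (begin
      4                                       ≤⟨ 4≤count ⟩
      count u (u ∷ x₁ ∷ H ++ b ∷ T)           ≡⟨ count-self u _ ⟩
      count u (x₁ ∷ H ++ b ∷ T)               ≤⟨ count-∷-≤ u x₁ _ ⟩
      suc (count u (H ++ b ∷ T))              ≡⟨ cong suc (count-++ u H (b ∷ T)) ⟩
      suc (count u H + count u (b ∷ T))       ≡⟨ cong (λ k → suc (k + count u (b ∷ T))) eq ⟩
      suc (count u (b ∷ T))                   ≤⟨ s≤s (count-∷-≤ u b T) ⟩
      suc (suc (count u T))                   ∎)))))
    where open ≤-Reasoning
  improve _ record { H = [] ; 2≤H = () }
  improve _ record { H = _ ∷ [] ; 2≤H = s≤s () }

  FullLobe : Set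
  FullLobe = ∃ λ L → let open Lobe L in TwoNeighboursIn u T × TwoNeighboursIn v T

  path-length-≤ : ∀ {xs u v} → Path xs u v → length xs ≤ n
  path-length-≤ {xs} (_ , uniq) = subst (length xs ≤_) (length-tabulate {n = n} (λ i → i)) (unique⇒length-≤ uniq λ _ → ∈-allFin _)

  module _ (4≤deg : ∀ v → 4 ≤ degree G v) where

    -- k bounds how often the path can still be extended, m the length of the head of the lobe.
    grow   : ∀ k {xs u v} → Path xs u v → n < length xs + k → FullLobe
    shrink : ∀ k m (L : Lobe) → length (Lobe.H L) < m → n ≤ Lobe.total L + k → FullLobe

    -- With no budget left the path would have more than `n` vertices.
    grow zero p n< = ⊥-elim (<⇒≱ (subst (n <_) (+-identityʳ _) n<) (path-length-≤ p))
    grow (suc k) {xs} {u} p n< with outside-neighbour? u xs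
    ... | inj₁ (x , u~x , x∉) = grow k (extend p u~x x∉) (subst (n <_) (+-suc (length xs) k) n<)
    ... | inj₂ deg≤ with p | ≤-trans (4≤deg u) deg≤
    ...   | [-] , _ | 4≤count = ⊥-elim (<⇒≱ (subst (0 <_) (count-self u []) (≤-trans (s≤s z≤n) 4≤count)) z≤n)
    ...   | _∷_ {xs = []} _ () , _ | _
    ...   | p′@(_∷_ {xs = x₁ ∷ ys} _ _ , _) | 4≤count with first-neighbour u ys 0<count
      where
      open ≤-Reasoning
      0<count : 0 < count u ys
      0<count = ≤-pred (≤-trans (s≤s (s≤s z≤n)) (begin
        4                         ≤⟨ 4≤count ⟩
        count u (u ∷ x₁ ∷ ys)     ≡⟨ count-self u _ ⟩
        count u (x₁ ∷ ys)         ≤⟨ count-∷-≤ u x₁ ys ⟩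
        suc (count u ys)          ∎))
    -- A neighbour beyond `x₁` ends a chord. The path keeps its length while `k` drops by one, which
    -- the change from a strict to a weak bound absorbs; strictness returns once the path gets
    -- longer.
    ...     | as , y , bs , refl , u~y , _ = shrink k _ (chord⇒lobe as p′ u~y) ≤-refl
      (subst (λ l → n ≤ suc (suc l) + k) (length-++ as) (≤-pred (subst (n <_) (+-suc (length (u ∷ x₁ ∷ ys)) k) n<)))

    shrink k (suc m) L H<m n≤ with improve 4≤deg L
    ... | inj₁ (xs , _ , _ , p , longer) = grow k p (≤-<-trans n≤ (+-monoˡ-< k longer))
    ... | inj₂ (inj₁ (L′ , total≡ , H′<H)) =
      shrink k m L′ (<-≤-trans H′<H (≤-pred H<m)) (subst (λ t → n ≤ t + k) (≡.sym total≡) n≤)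
    -- The end `u` is settled; the end `v` is now treated as the start of the reversed lobe.
    ... | inj₂ (inj₂ two-u) with improve 4≤deg (reverse-lobe L)
    ...   | inj₁ (xs , _ , _ , p , longer) = grow k p (≤-<-trans n≤ (+-monoˡ-< k (subst (_< length xs) (total-reverse L) longer)))
    ...   | inj₂ (inj₁ (L′ , total≡ , H′<H)) =
      shrink k m L′ (<-≤-trans (subst (length (Lobe.H L′) <_) (length-reverse (Lobe.H L)) H′<H) (≤-pred H<m))
        (subst (λ t → n ≤ t + k) (≡.sym (trans total≡ (total-reverse L))) n≤)
    ...   | inj₂ (inj₂ two-v) = L , two-u , two-v

  -- Cycle lengths forced by a lobe.

  chain-nonempty : ∀ {xs u v} → Chain xs u v → 1 ≤ length xs
  chain-nonempty [-]     = s≤s z≤n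
  chain-nonempty (_ ∷ _) = s≤s z≤n

  module LobeCycles (L : Lobe) where
    open Lobe L

    u∈H : u ∈ H
    u∈H = chain-∈ˡ (proj₁ path-H)

    v∈H : v ∈ H
    v∈H = chain-∈ʳ (proj₁ path-H)

    close-H : ∀ {S p q} → Path S p q → S ⊆ b ∷ T → Adj G v p → Adj G u q →
              HasCycleOfLength G (length H + length S)
    close-H path-S S⊆ v~p u~q = two-paths⇒cycle path-H path-S
      (λ (x∈H , x∈S) → disjoint (x∈H , S⊆ x∈S)) v~p (adj-sym u~q)
      (+-mono-≤ 2≤H (chain-nonempty (proj₁ path-S)))

    close-u : ∀ {S p q} → Path S p q → S ⊆ b ∷ T → 2 ≤ length S → Adj G u p → Adj G u q →
              HasCycleOfLength G (1 + length S)
    close-u path-S S⊆ 2≤S u~p u~q = two-paths⇒cycle ([-] , [] ∷ []) path-S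
      (λ { (here refl , x∈S) → disjoint (u∈H , S⊆ x∈S) }) u~p (adj-sym u~q) (s≤s 2≤S)

    -- The detour already visits `b`, hence `S` must lie in `T` and not merely in `b ∷ T`.
    close-ubv : ∀ {S p q} → Path S p q → S ⊆ T → Adj G v p → Adj G u q →
                HasCycleOfLength G (3 + length S)
    close-ubv {S} path-S S⊆ v~p u~q = two-paths⇒cycle
      (u~b ∷ adj-sym v~b ∷ [-] ,
       (adj⇒≢ u~b ∷ path-ends-≢ path-H 2≤H ∷ []) ∷ (adj⇒≢ (adj-sym v~b) ∷ []) ∷ [] ∷ [])
      path-S disj v~p (adj-sym u~q) (s≤s (s≤s (s≤s z≤n)))
      where
      disj : Disjoint (u ∷ b ∷ v ∷ []) S
      disj (here refl , x∈S)                 = disjoint (u∈H , there (S⊆ x∈S))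
      disj (there (here refl) , x∈S)         = Unique.Unique[x∷xs]⇒x∉xs (proj₂ path-T) (S⊆ x∈S)
      disj (there (there (here refl)) , x∈S) = disjoint (v∈H , there (S⊆ x∈S))

    -- Here `y` and `z` are distances along the tail, so the segments have one vertex more. The
    -- first triple closes segments through `u` alone, the second through all of `H`, the first of
    -- these segments being `b` by itself.
    fan : ∀ as bs {c d cs} → T ≡ as ++ c ∷ bs ++ d ∷ cs → Adj G u c → Adj G u d →
          let h = length H ; y = suc (length as) ; z = suc (length bs) in
          (HasCycleOfLength G (1 + (y + 1)) × HasCycleOfLength G (1 + (z + 1)) × HasCycleOfLength G (1 + (y + z + 1))) ×
          (HasCycleOfLength G (h + 1) × HasCycleOfLength G (h + (y + 1)) × HasCycleOfLength G (h + (y + z + 1)))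
    fan as bs {c} {d} {cs} refl u~c u~d =
      ( subst (λ l → HasCycleOfLength G (1 + l)) |bc| (close-u bc bc⊆ (s≤s (nonempty as)) u~b u~c)
      , subst (λ l → HasCycleOfLength G (1 + l)) |cd| (close-u cd cd⊆ (s≤s (nonempty bs)) u~c u~d)
      , subst (λ l → HasCycleOfLength G (1 + l)) |bd| (close-u bd bd⊆ (s≤s (nonempty (as ++ c ∷ bs))) u~b u~d) ) ,
      ( close-H ([-] , [] ∷ []) (λ { (here refl) → here refl }) v~b u~b
      , subst (λ l → HasCycleOfLength G (length H + l)) |bc| (close-H bc bc⊆ v~b u~c)
      , subst (λ l → HasCycleOfLength G (length H + l)) |bd| (close-H bd bd⊆ v~b u~d) )
      where
      nonempty : ∀ xs {x : Fin n} → 1 ≤ length (xs ++ [ x ])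
      nonempty []      = s≤s z≤n
      nonempty (_ ∷ _) = s≤s z≤n

      reassociate : (b ∷ as ++ c ∷ bs) ++ d ∷ cs ≡ b ∷ T
      reassociate = cong (b ∷_) (++-assoc as (c ∷ bs) (d ∷ cs))

      bc : Path (b ∷ as ++ [ c ]) b c
      bc = path-prefix (b ∷ as) path-T
      cd : Path (c ∷ bs ++ [ d ]) c d
      cd = path-prefix (c ∷ bs) (path-suffix (b ∷ as) path-T)
      bd : Path (b ∷ (as ++ c ∷ bs) ++ [ d ]) b d
      bd = path-prefix (b ∷ as ++ c ∷ bs) (subst (λ xs → Path xs b e) (≡.sym reassociate) path-T)

      bc⊆ : b ∷ as ++ [ c ] ⊆ b ∷ T
      bc⊆ = ∈-prefix (b ∷ as)
      cd⊆ : c ∷ bs ++ [ d ] ⊆ b ∷ T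
      cd⊆ x∈ = ∈-++⁺ʳ (b ∷ as) (∈-prefix (c ∷ bs) x∈)
      bd⊆ : b ∷ (as ++ c ∷ bs) ++ [ d ] ⊆ b ∷ T
      bd⊆ {x} x∈ = subst (x ∈_) reassociate (∈-prefix (b ∷ as ++ c ∷ bs) x∈)

      |bc| : length (b ∷ as ++ [ c ]) ≡ suc (length as) + 1
      |bc| = cong suc (length-++ as)
      |cd| : length (c ∷ bs ++ [ d ]) ≡ suc (length bs) + 1
      |cd| = cong suc (length-++ bs)
      |bd| : length (b ∷ (as ++ c ∷ bs) ++ [ d ]) ≡ suc (length as) + suc (length bs) + 1
      |bd| = cong suc (trans (length-++ (as ++ c ∷ bs)) (cong (_+ 1) (length-++ as)))

    bridge : ∀ xs ms {p q ys} → T ≡ xs ++ p ∷ ms ++ q ∷ ys → Adj G v p → Adj G u q →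
             let g = suc (length ms) in
             HasCycleOfLength G (3 + (g + 1)) × HasCycleOfLength G (length H + (g + 1))
    bridge xs ms {p} {q} refl v~p u~q =
      subst (λ l → HasCycleOfLength G (3 + l)) |pq| (close-ubv pq pq⊆ v~p u~q) ,
      subst (λ l → HasCycleOfLength G (length H + l)) |pq| (close-H pq (there ∘ pq⊆) v~p u~q)
      where
      pq : Path (p ∷ ms ++ [ q ]) p q
      pq = path-prefix (p ∷ ms) (path-suffix (b ∷ xs) path-T)
      pq⊆ : p ∷ ms ++ [ q ] ⊆ T
      pq⊆ x∈ = ∈-++⁺ʳ xs (∈-prefix (p ∷ ms) x∈)
      |pq| : length (p ∷ ms ++ [ q ]) ≡ suc (length ms) + 1
      |pq| = cong suc (length-++ ms)

  -- `bridge` handles a neighbour of `v` that precedes one of `u`; the other order is the same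
  -- statement for the reversed lobe. The final alternative expresses `g` as the difference of the
  -- two positions.
  crossing : ∀ L → let open Lobe L in ∀ xs zs {ys ws c w} → T ≡ xs ++ c ∷ ys → T ≡ zs ++ w ∷ ws →
    Adj G u c → Adj G v w → c ≢ w →
    ∃ λ g → (HasCycleOfLength G (3 + (g + 1)) × HasCycleOfLength G (length H + (g + 1))) ×
            (length xs + g ≡ length zs ⊎ length zs + g ≡ length xs)
  crossing L xs zs {c = c} {w} eq₁ eq₂ u~c v~w c≢w with compare-splits xs zs (trans (≡.sym eq₁) eq₂)
  ... | same _ c≡w         = ⊥-elim (c≢w c≡w)
  ... | before ms refl refl = suc (length ms) ,
      subst (λ h → HasCycleOfLength G (3 + (g + 1)) × HasCycleOfLength G (h + (g + 1))) (length-reverse (Lobe.H L))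
        (LobeCycles.bridge (reverse-lobe L) xs ms eq₁ u~c v~w) ,
      inj₁ (≡.sym (length-++ xs))
    where g = suc (length ms)
  ... | after ms refl refl  = suc (length ms) , LobeCycles.bridge L zs ms eq₂ v~w u~c , inj₂ (≡.sym (length-++ zs))

  no-full-lobe : ∀ {i j : Fin 4} → ¬ (i ≡ j) → odd (toℕ i) ≡ true ⊎ odd (toℕ j) ≡ true →
    (∀ k → HasCycleOfLength G k → Allowed i j k) → ¬ FullLobe
  no-full-lobe {i} {j} i≢j o allowed
    (L , (as , c , bs , d , _ , T≡u , u~c , u~d) , (as′ , s , bs′ , t , cs′ , T≡v , v~s , v~t)) =
    contradictory (c Fin.≟ s)
    where
    open Lobe L
    h = length H
    y = suc (length as)
    z = suc (length bs)
    y′ = suc (length as′)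
    z′ = suc (length bs′)

    fan-alternatives : ∀ L as bs {c d cs} → Lobe.T L ≡ as ++ c ∷ bs ++ d ∷ cs →
      Adj G (Lobe.u L) c → Adj G (Lobe.u L) d →
      Allowed i j (1 + (suc (length as) + 1)) ×
      NotOpposite i j × (length (Lobe.H L) ≈₄ 1 ⊎ (suc (length as) ≈₄ 0 × suc (length bs) ≈₄ 0))
    fan-alternatives L as bs T≡ ~c ~d with LobeCycles.fan L as bs T≡ ~c ~d
    ... | (c₁ , c₂ , c₃) , (c₄ , c₅ , c₆) = allowed _ c₁ ,
      fan-residues i≢j o _ (suc (length as)) (suc (length bs))
        (allowed _ c₁) (allowed _ c₂) (allowed _ c₃) (allowed _ c₄) (allowed _ c₅) (allowed _ c₆)

    from-u : Allowed i j (1 + (y + 1)) × NotOpposite i j × (h ≈₄ 1 ⊎ (y ≈₄ 0 × z ≈₄ 0))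
    from-u = fan-alternatives L as bs T≡u u~c u~d

    from-v : h ≈₄ 1 ⊎ (y′ ≈₄ 0 × z′ ≈₄ 0)
    from-v = subst (λ k → k ≈₄ 1 ⊎ (y′ ≈₄ 0 × z′ ≈₄ 0)) (length-reverse H)
      (proj₂ (proj₂ (fan-alternatives (reverse-lobe L) as′ bs′ T≡v v~s v~t)))

    meet : ∀ zs {w ws} → T ≡ zs ++ w ∷ ws → Adj G v w → c ≢ w → h ≈₄ 1 ⊎ suc (length zs) ≈₄ 0 → ⊥
    meet zs T≡ v~w c≢w from-w with crossing L as zs T≡u T≡ u~c v~w c≢w | from-u
    ... | g , (c₁ , c₂) , offset | a , opp , alt =
      crossing-residues opp h y g (allowed _ c₁) (allowed _ c₂) a (combine alt from-w)
      where
      combine : h ≈₄ 1 ⊎ (y ≈₄ 0 × z ≈₄ 0) → h ≈₄ 1 ⊎ suc (length zs) ≈₄ 0 → h ≈₄ 1 ⊎ (y ≈₄ 0 × g ≈₄ 0)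
      combine (inj₁ p)       _        = inj₁ p
      combine (inj₂ _)       (inj₁ p) = inj₁ p
      -- The distances from `b` to `c` and to `w` both vanish modulo 4, hence so does their
      -- difference `g`.
      combine (inj₂ (p , _)) (inj₂ q) = inj₂ (p ,
        [ (λ eq → +-cancel₄ p (subst (_≈₄ 0) (cong suc (≡.sym eq)) q))
        , (λ eq → +-cancel₄ q (subst (_≈₄ 0) (cong suc (≡.sym eq)) p)) ]′ offset)

    contradictory : Dec (c ≡ s) → ⊥
    contradictory (no c≢s)  = meet as′ T≡v v~s c≢s (Sum.map (λ p → p) proj₁ from-v)
    -- Now `t` plays the role of `w`; its distance from `b` is `y′ + z′`, which vanishes modulo 4
    -- when both summands do.
    contradictory (yes refl) = meet (as′ ++ s ∷ bs′) (trans T≡v (≡.sym (++-assoc as′ (s ∷ bs′) _))) v~t c≢t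
      (Sum.map (λ p → p) (λ (p , q) → subst (_≈₄ 0) (cong suc (≡.sym (length-++ as′))) (+-cong₄ p q)) from-v)
      where
      uniq-T : Unique (as′ ++ s ∷ bs′ ++ t ∷ cs′)
      uniq-T = subst Unique T≡v (proj₁ (proj₂ (unique-++⁻ [ b ] (proj₂ path-T))))
      c≢t : c ≢ t
      c≢t refl = Unique.Unique[x∷xs]⇒x∉xs (proj₁ (proj₂ (unique-++⁻ as′ uniq-T))) (∈-insert bs′)

  -- Cycles in 2-regular graphs.

  IsClosedPath : List (Fin n) → Set
  IsClosedPath c = ∃ λ u → ∃ λ v → Path c u v × Adj G v u × 3 ≤ length c

  cycle⇒closed-path : ∀ {c} → IsCycle G c → IsClosedPath c
  cycle⇒closed-path {x ∷ xs} (3≤ , uniq , linked) with linked⇒chain x xs linked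
  ... | v , c , v~x = x , v , (c , uniq) , v~x , 3≤

  -- With `w` in front, its two neighbours on the cycle are the second and the last entry.
  rotate : ∀ xs {w ys} → IsClosedPath (xs ++ w ∷ ys) → ∃ λ v → Path (w ∷ ys ++ xs) w v × Adj G v w × 3 ≤ length (w ∷ ys ++ xs)
  rotate [] {w} {ys} (u , v , (c , uniq) , v~u , 3≤) with chain-head c
  ... | refl = subst (λ zs → ∃ λ v → Path (w ∷ zs) w v × Adj G v w × 3 ≤ length (w ∷ zs)) (≡.sym (++-identityʳ ys))
                 (v , (c , uniq) , v~u , 3≤)
  rotate (x ∷ xs) {w} {ys} (u , v , (c , uniq) , v~u , 3≤) with chain-split xs c
  ... | p , c₁ , p~w , c₂ = p ,
    (chain-++ c₂ v~u c₁ , unique-resp-↭ (++-comm (x ∷ xs) (w ∷ ys)) uniq) , p~w ,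
    subst (3 ≤_) (↭-length (++-comm (x ∷ xs) (w ∷ ys))) 3≤

  closed-path-neighbours : ∀ {xs u v} → Path xs u v → Adj G v u → 3 ≤ length xs →
    ∃ λ y → ∃ λ z → y ≢ z × (y ∈ xs × z ∈ xs) × (Adj G u y × Adj G u z)
  closed-path-neighbours (u~y ∷ c@(_ ∷ d) , _ ∷ y∉ ∷ _) v~u _ = _ , _ ,
    (λ { refl → All.lookup y∉ (chain-∈ʳ d) refl }) ,
    (there (chain-∈ˡ c) , there (chain-∈ʳ c)) , u~y , adj-sym v~u
  closed-path-neighbours (_ ∷ [-] , _) _ (s≤s (s≤s ()))
  closed-path-neighbours ([-] , _) _ (s≤s ())

  cycle-neighbours : ∀ {c w} → IsCycle G c → w ∈ c →
    ∃ λ y → ∃ λ z → y ≢ z × (y ∈ c × z ∈ c) × (Adj G w y × Adj G w z)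
  cycle-neighbours {w = w} isCycle w∈c with ∈-∃++ w∈c
  ... | xs , ys , refl =
    let _ , path , v~w , 3≤ = rotate xs (cycle⇒closed-path isCycle)
        y , z , y≢z , (y∈ , z∈) , adjacent = closed-path-neighbours path v~w 3≤
    in y , z , y≢z , (∈-resp-↭ rotation y∈ , ∈-resp-↭ rotation z∈) , adjacent
    where
    rotation : w ∷ ys ++ xs ↭ xs ++ w ∷ ys
    rotation = ++-comm (w ∷ ys) xs

  cycle⇒2≤degree : ∀ {c w} → IsCycle G c → w ∈ c → 2 ≤ degree G w
  cycle⇒2≤degree isCycle w∈c with cycle-neighbours isCycle w∈c
  ... | y , z , y≢z , _ , w~y , w~z =
    neighbours-≤-degree ((y≢z ∷ []) ∷ [] ∷ []) (w~y ∷ w~z ∷ [])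

  -- A walk cannot leave the cycle: the edge by which it left would give its start a third
  -- neighbour.
  cycle-spans : ∀ {c} → (∀ w → degree G w ≡ 2) → IsCycle G c → ∀ {w x} → Walk G w x → w ∈ c → x ∈ c
  cycle-spans deg≡2 isCycle here            w∈c = w∈c
  cycle-spans {c} deg≡2 isCycle (step {w = w′} w~w′ walk) w∈c with w′ ∈? c
  ... | yes w′∈c = cycle-spans deg≡2 isCycle walk w′∈c
  ... | no w′∉c with cycle-neighbours isCycle w∈c
  ...   | y , z , y≢z , (y∈c , z∈c) , w~y , w~z = ⊥-elim (<⇒≱ (neighbours-≤-degree
            ((y≢z ∷ (λ { refl → w′∉c y∈c }) ∷ []) ∷ ((λ { refl → w′∉c z∈c }) ∷ []) ∷ [] ∷ [])
            (w~y ∷ w~z ∷ w~w′ ∷ [])) (≤-reflexive (deg≡2 _)))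

  2-regular-cycle-≤ : Connected G → (∀ w → degree G w ≡ 2) → ∀ {k l} →
    HasCycleOfLength G k → HasCycleOfLength G l → k ≤ l
  2-regular-cycle-≤ conn deg≡2 (c@(_ ∷ _) , (_ , uniq , _) , refl) (d@(x ∷ _) , d-cycle , refl) =
    unique⇒length-≤ uniq λ {w} _ → cycle-spans deg≡2 d-cycle (conn x w) (here refl)

  -- Odd closed walks and bipartiteness.

  -- A repeated vertex splits a closed walk into two shorter ones whose lengths add up to the
  -- original, so one of them is odd. The bound `m` makes the recursion structural.
  odd-closed-walk⇒odd-cycle : ∀ m {xs u v} → length xs < m → Chain xs u v → Adj G v u →
    odd (length xs) ≡ true → ∃ λ k → HasCycleOfLength G k × odd k ≡ true
  odd-closed-walk⇒odd-cycle (suc m) {xs} xs<m c v~u odd-xs with repetition? Fin._≟_ xs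
  ... | inj₁ uniq = length xs , cycle c v~u uniq (3≤length c v~u odd-xs) , odd-xs
    where
    3≤length : ∀ {xs u v} → Chain xs u v → Adj G v u → odd (length xs) ≡ true → 3 ≤ length xs
    -- Length one would be a loop, and length two is not odd.
    3≤length [-]             v~u _  = ⊥-elim (adj-irrefl v~u)
    3≤length (_ ∷ [-])       _   ()
    3≤length (_ ∷ _ ∷ [-])   _   _  = ≤-refl
    3≤length (_ ∷ _ ∷ _ ∷ _) _   _  = s≤s (s≤s (s≤s z≤n))
  ... | inj₂ (as , x , bs , cs , refl) with odd (suc (length bs)) in odd-bs
  ...   | true with chain-split bs (chain-suffix as c)
  ...     | _ , c₁ , w~x , _ = odd-closed-walk⇒odd-cycle m (≤-trans shorter (≤-pred xs<m)) c₁ w~x odd-bs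
    where
    shorter : suc (length (x ∷ bs)) ≤ length (as ++ x ∷ bs ++ x ∷ cs)
    shorter = begin
      suc (length (x ∷ bs))                              ≤⟨ m<m+n (length (x ∷ bs)) (s≤s z≤n) ⟩
      length (x ∷ bs) + length (x ∷ cs)                  ≡⟨ ≡.sym (length-++ (x ∷ bs)) ⟩
      length (x ∷ bs ++ x ∷ cs)                          ≤⟨ m≤n+m _ (length as) ⟩
      length as + length (x ∷ bs ++ x ∷ cs)              ≡⟨ ≡.sym (length-++ as) ⟩
      length (as ++ x ∷ bs ++ x ∷ cs)                    ∎
      where open ≤-Reasoning
  odd-closed-walk⇒odd-cycle (suc m) xs<m c v~u odd-xs | inj₂ (as , x , bs , cs , refl) | false =
    odd-closed-walk⇒odd-cycle m (≤-trans shorter (≤-pred xs<m))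
      (chain-replace as c (chain-suffix (x ∷ bs) (chain-suffix as c))) v~u still-odd
    where
    total≡ : length (as ++ x ∷ bs ++ x ∷ cs) ≡ suc (length bs) + length (as ++ x ∷ cs)
    total≡ = trans (↭-length (shifts as (x ∷ bs))) (length-++ (x ∷ bs))
    shorter : length (as ++ x ∷ cs) < length (as ++ x ∷ bs ++ x ∷ cs)
    shorter = subst (length (as ++ x ∷ cs) <_) (≡.sym total≡) (m<n+m _ (s≤s z≤n))
    still-odd : odd (length (as ++ x ∷ cs)) ≡ true
    still-odd = begin
      odd (length (as ++ x ∷ cs))                                  ≡⟨ cong (_xor odd (length (as ++ x ∷ cs))) (≡.sym odd-bs) ⟩
      odd (suc (length bs)) xor odd (length (as ++ x ∷ cs))        ≡⟨ ≡.sym (odd-+ (suc (length bs)) _) ⟩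
      odd (suc (length bs) + length (as ++ x ∷ cs))                ≡⟨ cong odd (≡.sym total≡) ⟩
      odd (length (as ++ x ∷ bs ++ x ∷ cs))                        ≡⟨ odd-xs ⟩
      true                                                         ∎
      where open ≡.≡-Reasoning

  walk-length : ∀ {u v} → Walk G u v → ℕ
  walk-length here          = 0
  walk-length (step _ walk) = suc (walk-length walk)

  walk⇒chain : ∀ {u v} (walk : Walk G u v) → ∃ λ xs → Chain (u ∷ xs) u v × length xs ≡ walk-length walk
  walk⇒chain here          = [] , [-] , refl
  walk⇒chain (step a walk) with walk⇒chain walk
  ... | xs , c , eq = _ , a ∷ c , cong suc eq

  -- Colour each vertex by the parity of the chosen walk from `r`. An edge between equal colours,
  -- with the walks to its ends, closes up to an odd walk.
  no-odd-cycle⇒bipartite : Fin n → Connected G → (∀ k → HasCycleOfLength G k → odd k ≡ false) → Bipartite G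
  no-odd-cycle⇒bipartite r conn even = (λ v → odd (walk-length (conn r v))) , λ u v u~v same-colour →
    let k , cyc , odd-k = odd-cycle (walk⇒chain (conn r u)) (walk⇒chain (conn r v)) u~v same-colour
    in Bool.not-¬ (even k cyc) odd-k
    where
    odd-cycle : ∀ {u v} {l m} → (∃ λ xs → Chain (r ∷ xs) r u × length xs ≡ l) →
      (∃ λ ys → Chain (r ∷ ys) r v × length ys ≡ m) → Adj G u v → odd l ≡ odd m →
      ∃ λ k → HasCycleOfLength G k × odd k ≡ true
    -- If the second walk is trivial then `v` is `r` and the edge itself closes the walk; otherwise
    -- the second walk is reversed without `r`, which is thus not counted twice.
    odd-cycle (xs , c , refl) ([] , [-] , refl) u~v eq =
      odd-closed-walk⇒odd-cycle _ ≤-refl c u~v (cong not eq)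
    odd-cycle (xs , c , refl) (ys , a ∷ d , refl) u~v eq =
      odd-closed-walk⇒odd-cycle _ ≤-refl (chain-++ c u~v (chain-reverse d)) (adj-sym a) (begin
        odd (length (r ∷ xs ++ reverse ys))         ≡⟨ cong odd (length-++ (r ∷ xs)) ⟩
        odd (suc (length xs + length (reverse ys))) ≡⟨ cong (λ l → odd (suc (length xs + l))) (length-reverse ys) ⟩
        odd (suc (length xs) + length ys)           ≡⟨ odd-+ (suc (length xs)) (length ys) ⟩
        not (odd (length xs)) xor odd (length ys)   ≡⟨ cong (λ p → not p xor odd (length ys)) eq ⟩
        not (odd (length ys)) xor odd (length ys)   ≡⟨ not-xor-same (odd (length ys)) ⟩
        true                                        ∎)
      where
      open ≡.≡-Reasoning
      not-xor-same : ∀ p → not p xor p ≡ true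
      not-xor-same true  = refl
      not-xor-same false = refl

-- Regular Euler graphs with two cycle types.

theorem27 : (n : ℕ) (G : Graph n) (i j : Fin 4) → ¬ (i ≡ j) →
    Euler G → InEpsilon i j G →
    (Regular G ⇔ (∃ λ d → RegularOfDegree G d × 2 < d × Bipartite G × Euler G))
theorem27 n G i j i≢j euler@(conn , even-degree) (allowed , (k , k-cycle , k-type) , (l , l-cycle , l-type)) =
  mk⇔ forward (λ (d , regular , _) → d , regular)
  where
  on-cycle : HasCycleOfLength G k → ∃ λ c → ∃ λ r → IsCycle G c × r ∈ c
  on-cycle (c@(r ∷ _) , isCycle , _) = c , r , isCycle , here refl

  root : Fin n
  root = proj₁ (proj₂ (on-cycle k-cycle))

  2≤degree : 2 ≤ degree G root
  2≤degree = let _ , _ , isCycle , r∈c = on-cycle k-cycle in cycle⇒2≤degree G isCycle r∈c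

  not-2-regular : ¬ RegularOfDegree G 2
  not-2-regular deg≡2 = i≢j (Fin.toℕ-injective (trans (≡.sym k-type) (trans (cong (_% 4) k≡l) l-type)))
    where
    k≡l : k ≡ l
    k≡l = ≤-antisym (2-regular-cycle-≤ G conn deg≡2 k-cycle l-cycle)
                    (2-regular-cycle-≤ G conn deg≡2 l-cycle k-cycle)

  -- Degrees 0 and 1 fail because `root` lies on a cycle, 2 because of the two cycle types, and 3 by
  -- parity.
  degree-≥-4 : ∀ d → RegularOfDegree G d → 4 ≤ d
  degree-≥-4 d regular with subst (2 ≤_) (regular root) 2≤degree | subst (2 ∣_) (regular root) (even-degree root)
  degree-≥-4 1 _       | s≤s () | _
  degree-≥-4 2 regular | _ | _   = ⊥-elim (not-2-regular regular)
  degree-≥-4 3 _       | _ | 2∣3 = ⊥-elim (from-no (2 ∣? 3) 2∣3)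
  degree-≥-4 (suc (suc (suc (suc d)))) _ | _ | _ = s≤s (s≤s (s≤s (s≤s z≤n)))

  bipartite : (∀ v → 4 ≤ degree G v) → Bipartite G
  bipartite 4≤deg with odd (toℕ i) in odd-i | odd (toℕ j) in odd-j
  -- Growth starts from the one-vertex path at `root`; with budget `n` the required bound reads
  -- `n < 1 + n`.
  ... | true  | _     = ⊥-elim (no-full-lobe G i≢j (inj₁ odd-i) allowed (grow G 4≤deg n {v = root} ([-] , [] ∷ []) ≤-refl))
  ... | false | true  = ⊥-elim (no-full-lobe G i≢j (inj₂ odd-j) allowed (grow G 4≤deg n {v = root} ([-] , [] ∷ []) ≤-refl))
  ... | false | false = no-odd-cycle⇒bipartite G root conn λ m m-cycle →
    [ (λ eq → trans (odd-%4 m) (trans (cong odd eq) odd-i))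
    , (λ eq → trans (odd-%4 m) (trans (cong odd eq) odd-j)) ]′ (allowed m m-cycle)

  forward : Regular G → ∃ λ d → RegularOfDegree G d × 2 < d × Bipartite G × Euler G
  forward (d , regular) = d , regular , ≤-trans (n≤1+n 3) 4≤d ,
    bipartite (λ v → subst (4 ≤_) (≡.sym (regular v)) 4≤d) , euler
    where 4≤d = degree-≥-4 d regular
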